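{- For every $M>0$, no deterministic algorithm can achieve a competitive ratio better than $\frac{1}{M}$ for online Submodular Welfare in the adversarial setting with general (not necessarily monotone) non-negative submodular utilities.
   Context: A set function $f:2^{\mathcal N}\to\mathbb R_{\ge 0}$ is submodular if $f(A\cup B)+f(A\cap B)\le f(A)+f(B)$ for all $A,B\subseteq\mathcal N$. Online Submodular Welfare: there are $n$ bidders, bidder $j$ having a non-negative submodular (not necessarily monotone) utility $f_j$ over a set $\mathcal N$ of items that arrive one by one. When an item arrives, the algorithm must immediately and irrevocably assign it to one bidder or discard it; the goal is to maximize $\sum_j f_j(S_j)$, where $S_j$ is the set of items assigned to bidder $j$ (pairwise disjoint). Utilities are accessed via value oracles, and upon an item's arrival the algorithm may only query sets of items that already arrived. In the adversarial setting an adversary chooses the arrival order (and, since only queries on arrived items are possible, the instance may depend on the algorithm's earlier decisions). An algorithm has competitive ratio $\alpha$ if on every instance its value is at least $\alpha$ times the optimal offline value. -}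

module Defs where

open import Algebra.Bundles using (CommutativeRing)
open import Algebra.Definitions using (Invertible)
import Algebra.Definitions.RawMonoid
open import Data.Fin.Base using (Fin; toℕ)
open import Data.Fin.Permutation using (Permutation′; _⟨$⟩ʳ_)
open import Data.Fin.Subset using (Subset; inside; outside; _∪_; _∩_; ⁅_⁆; ⊥; Empty)
open import Data.List.Base using (List; []; _∷_; tabulate)
open import Data.Maybe.Base using (Maybe; just; nothing)
open import Data.Nat.Base as ℕ using (ℕ; suc)
open import Data.Product.Base using (∃; _×_; _,_; proj₁)
open import Data.Sum.Base using (_⊎_; inj₂)
open import Data.Vec.Base using (Vec; []; _∷_)
open import Data.Vec.Functional using (updateAt)
open import Level using (0ℓ)
open import Relation.Binary.Core using (Rel)
open import Relation.Binary.Definitions using (Cotransitive)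
open import Relation.Binary.PropositionalEquality.Core using (_≢_)
open import Relation.Binary.Structures using (IsStrictPartialOrder)
open import Relation.Nullary.Negation.Core using (¬_)

-- The real numbers, axiomatised as a Cauchy-complete Archimedean ordered
-- field.  Classically these axioms determine ℝ up to isomorphism.  The strict
-- order is primitive and is only required to be cotransitive (not trichotomous),
-- so that the axioms also hold constructively of the Cauchy reals.
record RealNumbers : Set₁ where
  infix 4 _<_ _≤_

  field
    commutativeRing : CommutativeRing 0ℓ 0ℓ

  open CommutativeRing commutativeRing public
    using (Carrier; _≈_; _+_; _*_; 0#; 1#; +-rawMonoid)

  field
    _<_                  : Rel Carrier 0ℓ
    isStrictPartialOrder : IsStrictPartialOrder _≈_ _<_
    <-cotrans            : Cotransitive _<_
    <-tight              : ∀ {x y} → ¬ x < y → ¬ y < x → x ≈ y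
    +-monoˡ-<            : ∀ {x y} z → x < y → x + z < y + z
    *-pos                : ∀ {x y} → 0# < x → 0# < y → 0# < x * y
    0<1                  : 0# < 1#
    invertible           : ∀ {x} → x < 0# ⊎ 0# < x → Invertible _≈_ 1# _*_ x

  _≤_ : Rel Carrier 0ℓ
  x ≤ y = ¬ (y < x)

  open Algebra.Definitions.RawMonoid +-rawMonoid public
    using (sum) renaming (_×_ to _·_)

  IsCauchy : (ℕ → Carrier) → Set
  IsCauchy s = ∀ {ε} → 0# < ε →
    ∃ λ N → ∀ {i j} → N ℕ.≤ i → N ℕ.≤ j → s i < s j + ε

  ConvergesTo : (ℕ → Carrier) → Carrier → Set
  ConvergesTo s l = ∀ {ε} → 0# < ε →
    ∃ λ N → ∀ {i} → N ℕ.≤ i → s i < l + ε × l < s i + ε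

  field
    archimedean : ∀ x → ∃ λ k → x < k · 1#
    complete    : ∀ s → IsCauchy s → ∃ (ConvergesTo s)

  reciprocal : ∀ x → 0# < x → Carrier
  reciprocal x 0<x = proj₁ (invertible (inj₂ 0<x))

module OnlineSubmodularWelfare (ℝ : RealNumbers) where

  open RealNumbers ℝ

  NonNegative : ∀ {m} → (Subset m → Carrier) → Set
  NonNegative f = ∀ A → 0# ≤ f A

  Submodular : ∀ {m} → (Subset m → Carrier) → Set
  Submodular f = ∀ A B → f (A ∪ B) + f (A ∩ B) ≤ f A + f B

  -- The item arriving at time i is  order ⟨$⟩ʳ i.
  record Instance (n : ℕ) : Set where
    field
      m          : ℕ
      utility    : Fin n → Subset m → Carrier
      nonNeg     : ∀ j → NonNegative (utility j)
      submodular : ∀ j → Submodular (utility j)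
      order      : Permutation′ m

  Bundles : ℕ → ℕ → Set
  Bundles n m = Fin n → Subset m

  Feasible : ∀ {n m} → Bundles n m → Set
  Feasible S = ∀ {i j} → i ≢ j → Empty (S i ∩ S j)

  module _ {n} (I : Instance n) where
    open Instance I

    welfare : Bundles n m → Carrier
    welfare S = sum (λ j → utility j (S j))

    Optimal : Bundles n m → Set
    Optimal S = Feasible S × (∀ T → Feasible T → welfare T ≤ welfare S)

  -- Adaptive computations with access to the value oracles of n bidders, each
  -- query being a bidder and a subset of the k items that have arrived so far.
  data OracleComp (n k : ℕ) (X : Set) : Set where
    return : X → OracleComp n k X
    query  : Fin n → Subset k → (Carrier → OracleComp n k X) → OracleComp n k X

  evaluate : ∀ {n k X} → (Fin n → Subset k → Carrier) → OracleComp n k X → X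
  evaluate oracle (return x)       = x
  evaluate oracle (query j S next) = evaluate oracle (next (oracle j S))

  -- A deterministic online algorithm with arbitrary internal memory.  When an
  -- item arrives after t earlier ones, the algorithm is given its name, may query
  -- sets of the suc t arrived items, and must assign the item to a bidder (just j)
  -- or discard it (nothing).  The number of items still to come is not revealed.
  -- In queries, the arrived items are indexed from the most recent (index zero)
  -- to the oldest.
  record Algorithm (n : ℕ) : Set₁ where
    field
      State     : Set
      initial   : State
      onArrival : (t : ℕ) → State → (name : ℕ) →
                  OracleComp n (suc t) (Maybe (Fin n) × State)

  select : ∀ {m k} → Vec (Fin m) k → Subset k → Subset m
  select []       []            = ⊥
  select (x ∷ xs) (inside  ∷ S) = ⁅ x ⁆ ∪ select xs S
  select (x ∷ xs) (outside ∷ S) = select xs S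

  assign : ∀ {n m} → Maybe (Fin n) → Fin m → Bundles n m → Bundles n m
  assign nothing  x S = S
  assign (just j) x S = updateAt S j (_∪ ⁅ x ⁆)

  module _ {n} (A : Algorithm n) (I : Instance n) where
    open Algorithm A
    open Instance I

    step : ∀ {t} → Vec (Fin m) t → State → Fin m → Maybe (Fin n) × State
    step {t} past s x =
      evaluate (λ j S → utility j (select (x ∷ past) S)) (onArrival t s (toℕ x))

    -- past: arrived items, most recent first; the list: items still to arrive.
    process : ∀ {t} → Vec (Fin m) t → State → Bundles n m → List (Fin m) → Bundles n m
    process past s S []       = S
    process past s S (x ∷ xs) =
      let (decision , s′) = step past s x
      in process (x ∷ past) s′ (assign decision x S) xs

    outcome : Bundles n m
    outcome = process [] initial (λ _ → ⊥) (tabulate (order ⟨$⟩ʳ_))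

  Competitive : ∀ {n} → Algorithm n → Carrier → Set
  Competitive {n} A α = (I : Instance n) → ∀ S → Optimal I S →
    α * welfare I S ≤ welfare I (outcome A I)

{-# OPTIONS --safe #-}
-- Only bidder zero has a non-trivial utility f, and two items u, v arrive in this
-- order, with f ∅ = 0 and f {u} = 1.  While only u has arrived, the algorithm cannot
-- distinguish f {v} = 0, f {u,v} = 1 from f {v} = 1 + M, f {u,v} = 0.  If it does not
-- give u to bidder zero, the first continuation leaves it with welfare 0 against 1;
-- if it does, the second leaves it with welfare at most 1 against 1 + M.
module Submission where

open import Algebra.Bundles using (CommutativeRing)
import Algebra.Properties.Monoid.Sum as Sum
open import Data.Empty as Empty using (⊥-elim)
open import Data.Fin.Base using (Fin; zero; suc)
import Data.Fin.Permutation as Permutation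
open import Data.Fin.Subset using (Subset; inside; outside; ⊥)
open import Data.Fin.Subset.Properties using (∉⊥; x∈p∩q⁻)
open import Data.Maybe.Base using (Maybe; just; nothing)
open import Data.Nat.Base using (ℕ; suc; NonZero)
open import Data.Product.Base using (_,_; proj₁; proj₂)
open import Data.Sum.Base using (inj₁; inj₂)
open import Data.Vec.Base using ([]; _∷_)
open import Relation.Binary.PropositionalEquality.Core as ≡ using (_≡_; _≢_)
open import Relation.Binary.Structures using (IsStrictPartialOrder)
import Relation.Binary.Reasoning.Setoid as SetoidReasoning
open import Relation.Nullary.Negation.Core using (¬_)
open import Defs

module OrderedField (ℝ : RealNumbers) where

  open RealNumbers ℝ
  open CommutativeRing commutativeRing
    using (-_; setoid; sym; +-congˡ; +-assoc; +-identityˡ; +-identityʳ;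
           -‿inverseʳ; -‿inverseˡ; distribʳ; zeroˡ; *-congʳ)
    renaming (refl to ≈-refl)
  open IsStrictPartialOrder isStrictPartialOrder
    using (irrefl; asym; <-respʳ-≈; <-respˡ-≈) renaming (trans to <-trans)

  <⇒≤ : ∀ {x y} → x < y → x ≤ y
  <⇒≤ = asym

  ≤-reflexive : ∀ {x y} → x ≈ y → x ≤ y
  ≤-reflexive x≈y = irrefl (sym x≈y)

  ≤-refl : ∀ {x} → x ≤ x
  ≤-refl = ≤-reflexive ≈-refl

  ≤-resp-≈ : ∀ {x x′ y y′} → x ≈ x′ → y ≈ y′ → x ≤ y → x′ ≤ y′
  ≤-resp-≈ x≈x′ y≈y′ x≤y y′<x′ = x≤y (<-respˡ-≈ (sym y≈y′) (<-respʳ-≈ (sym x≈x′) y′<x′))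

  -- As `<` is not trichotomous, cotransitivity does the case split: it places `x` relative to
  -- `y < z`.
  ≤-<-trans : ∀ {x y z} → x ≤ y → y < z → x < z
  ≤-<-trans {x} x≤y y<z with <-cotrans y<z x
  ... | inj₁ y<x = ⊥-elim (x≤y y<x)
  ... | inj₂ x<z = x<z

  x<y+x : ∀ {x y} → 0# < y → x < y + x
  x<y+x 0<y = <-respˡ-≈ (+-identityˡ _) (+-monoˡ-< _ 0<y)

  +-pos : ∀ {x y} → 0# < x → 0# < y → 0# < x + y
  +-pos 0<x 0<y = <-trans 0<y (x<y+x 0<x)

  -- The axioms only give positivity of products, so the positive amount `(y - x) * z` is added to
  -- `x * z`.
  *-monoˡ-<-pos : ∀ {x y z} → 0# < z → x < y → x * z < y * z
  *-monoˡ-<-pos {x} {y} {z} 0<z x<y = <-respʳ-≈ difference (x<y+x (*-pos 0<y-x 0<z))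
    where
    0<y-x : 0# < y + - x
    0<y-x = <-respˡ-≈ (-‿inverseʳ x) (+-monoˡ-< (- x) x<y)

    open SetoidReasoning setoid

    difference : (y + - x) * z + x * z ≈ y * z
    difference = begin
      (y + - x) * z + x * z  ≈⟨ distribʳ z (y + - x) x ⟨
      ((y + - x) + x) * z    ≈⟨ *-congʳ (+-assoc y (- x) x) ⟩
      (y + (- x + x)) * z    ≈⟨ *-congʳ (+-congˡ (-‿inverseˡ x)) ⟩
      (y + 0#) * z           ≈⟨ *-congʳ (+-identityʳ y) ⟩
      y * z                  ∎

  module _ {x} (0<x : 0# < x) where

    reciprocal<⇒1<* : ∀ {y} → reciprocal x 0<x < y → 1# < y * x
    reciprocal<⇒1<* r<y =
      <-respˡ-≈ (proj₁ (proj₂ (invertible (inj₂ 0<x)))) (*-monoˡ-<-pos 0<x r<y)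

    -- A negative reciprocal is impossible: multiplying by `x` would give `1# < 0# * x`.
    reciprocal<⇒pos : ∀ {y} → reciprocal x 0<x < y → 0# < y
    reciprocal<⇒pos r<y with <-cotrans r<y 0#
    ... | inj₂ 0<y = 0<y
    ... | inj₁ r<0 = ⊥-elim (asym 0<1 (<-respʳ-≈ (zeroˡ x) (reciprocal<⇒1<* r<0)))

module LowerBound (ℝ : RealNumbers) where

  open RealNumbers ℝ
  open CommutativeRing commutativeRing
    using (sym; trans; +-congˡ; +-congʳ; +-comm; +-identityʳ; +-monoid; *-identityʳ; *-congˡ;
           distribˡ)
    renaming (refl to ≈-refl)
  open IsStrictPartialOrder isStrictPartialOrder
    using (<-respʳ-≈) renaming (trans to <-trans)
  open OnlineSubmodularWelfare ℝ
  open OrderedField ℝ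

  -- A computation sees the utilities only through query answers. The answers must agree up to `≡`,
  -- since a continuation need not respect `≈`.
  evaluate-cong : ∀ {n k X} {f g : Fin n → Subset k → Carrier} → (∀ j S → f j S ≡ g j S) →
                  (c : OracleComp n k X) → evaluate f c ≡ evaluate g c
  evaluate-cong f≗g (return x) = ≡.refl
  evaluate-cong {g = g} f≗g (query j S next) rewrite f≗g j S =
    evaluate-cong f≗g (next (g j S))

  allToFirst : ∀ {n m} → Subset m → Bundles (suc n) m
  allToFirst X zero    = X
  allToFirst X (suc _) = ⊥

  allToFirst-feasible : ∀ {n m} (X : Subset m) → Feasible (allToFirst {n} X)
  allToFirst-feasible X {zero}  {zero}  i≢j _ = i≢j ≡.refl
  allToFirst-feasible X {zero}  {suc j} i≢j (_ , x∈) = ∉⊥ (proj₂ (x∈p∩q⁻ X ⊥ x∈))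
  allToFirst-feasible X {suc i} {j}     i≢j (_ , x∈) = ∉⊥ (proj₁ (x∈p∩q⁻ ⊥ (allToFirst X j) x∈))

  -- The two items are u = zero and v = suc zero.
  pattern ∅ₛ  = outside ∷ outside ∷ []
  pattern ⁅u⁆ = inside  ∷ outside ∷ []
  pattern ⁅v⁆ = outside ∷ inside  ∷ []
  pattern uv  = inside  ∷ inside  ∷ []

  module TwoItems (a b : Carrier) (0≤a : 0# ≤ a) (0≤b : 0# ≤ b) (b≤1+a : b ≤ 1# + a) where

    value : Subset 2 → Carrier
    value ∅ₛ  = 0#
    value ⁅u⁆ = 1#
    value ⁅v⁆ = a
    value uv  = b

    module _ {c} (0≤c : 0# ≤ c) (1≤c : 1# ≤ c) (a≤c : a ≤ c) (b≤c : b ≤ c) where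

      -- When `c` is the value of some bundle, this is the maximality that `allToFirst-optimal` asks
      -- for.
      value-≤ : ∀ X → value X ≤ c
      value-≤ ∅ₛ  = 0≤c
      value-≤ ⁅u⁆ = 1≤c
      value-≤ ⁅v⁆ = a≤c
      value-≤ uv  = b≤c

    value-nonNeg : NonNegative value
    value-nonNeg ∅ₛ  = ≤-refl
    value-nonNeg ⁅u⁆ = <⇒≤ 0<1
    value-nonNeg ⁅v⁆ = 0≤a
    value-nonNeg uv  = 0≤b

    -- For nested sets, union and intersection are the two sets themselves, so both sides agree. The
    -- only incomparable pair is `⁅u⁆`, `⁅v⁆`, where the inequality is `b≤1+a`.
    value-submodular : Submodular value
    value-submodular ∅ₛ  ∅ₛ  = ≤-refl
    value-submodular ∅ₛ  ⁅u⁆ = ≤-reflexive (+-comm _ _)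
    value-submodular ∅ₛ  ⁅v⁆ = ≤-reflexive (+-comm _ _)
    value-submodular ∅ₛ  uv  = ≤-reflexive (+-comm _ _)
    value-submodular ⁅u⁆ ∅ₛ  = ≤-refl
    value-submodular ⁅u⁆ ⁅u⁆ = ≤-refl
    value-submodular ⁅u⁆ ⁅v⁆ = ≤-resp-≈ (sym (+-identityʳ b)) ≈-refl b≤1+a
    value-submodular ⁅u⁆ uv  = ≤-reflexive (+-comm _ _)
    value-submodular ⁅v⁆ ∅ₛ  = ≤-refl
    value-submodular ⁅v⁆ ⁅u⁆ = ≤-resp-≈ (sym (+-identityʳ b)) (+-comm 1# a) b≤1+a
    value-submodular ⁅v⁆ ⁅v⁆ = ≤-refl
    value-submodular ⁅v⁆ uv  = ≤-reflexive (+-comm _ _)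
    value-submodular uv  ∅ₛ  = ≤-refl
    value-submodular uv  ⁅u⁆ = ≤-refl
    value-submodular uv  ⁅v⁆ = ≤-refl
    value-submodular uv  uv  = ≤-refl

    twoItems : ∀ n → Instance (suc n)
    twoItems n = record
      { m          = 2
      ; utility    = λ { zero → value ; (suc _) _ → 0# }
      ; nonNeg     = λ { zero → value-nonNeg ; (suc _) _ → ≤-refl }
      ; submodular = λ { zero → value-submodular ; (suc _) _ _ → ≤-refl }
      ; order      = Permutation.id
      }

    welfare-twoItems : ∀ {n} S → welfare (twoItems n) S ≈ value (S zero)
    welfare-twoItems {n} S =
      trans (+-congˡ (Sum.sum-replicate-zero +-monoid n)) (+-identityʳ _)

    allToFirst-optimal : ∀ {n} X → (∀ Y → value Y ≤ value X) →
                         Optimal (twoItems n) (allToFirst X)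
    allToFirst-optimal {n} X max =
      allToFirst-feasible X ,
      λ T _ → ≤-resp-≈ (sym (welfare-twoItems T))
                       (sym (welfare-twoItems {n} (allToFirst X))) (max (T zero))

    competitive⇒≤ : ∀ {n} (A : Algorithm (suc n)) {α} → Competitive A α →
                    ∀ X → (∀ Y → value Y ≤ value X) →
                    α * value X ≤ value (outcome A (twoItems n) zero)
    competitive⇒≤ {n} A comp X max =
      ≤-resp-≈ (*-congˡ (welfare-twoItems {n} (allToFirst X)))
               (welfare-twoItems (outcome A (twoItems n)))
               (comp (twoItems n) (allToFirst X) (allToFirst-optimal X max))

    -- With this decision named, `outcome` on two items unfolds by computation to two successive
    -- `assign`s, the form of `assignBoth`.
    secondDecision : ∀ {n} → Algorithm (suc n) → Maybe (Fin (suc n))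
    secondDecision {n} A =
      proj₁ (step A (twoItems n) (zero ∷ [])
                  (proj₂ (step A (twoItems n) [] (Algorithm.initial A) zero)) (suc zero))

  module _ {M} (0<M : 0# < M) {n} (A : Algorithm (suc n)) where

    open Algorithm A using (initial; onArrival)

    0<1+M : 0# < 1# + M
    0<1+M = +-pos 0<1 0<M

    1<1+M : 1# < 1# + M
    1<1+M = <-respʳ-≈ (+-comm M 1#) (x<y+x 0<M)

    -- In `Low`, `v` adds nothing to the empty bundle; in `High`, adding it to `u` destroys all
    -- value. Taking `1# + M` rather than `M` keeps `⁅v⁆` optimal in `High` even for `M` below `1#`.
    module Low  = TwoItems 0# 1# ≤-refl (<⇒≤ 0<1) (≤-reflexive (sym (+-identityʳ 1#)))
    module High = TwoItems (1# + M) 0# (<⇒≤ 0<1+M) ≤-refl (<⇒≤ (+-pos 0<1 0<1+M))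

    low high : Instance (suc n)
    low  = Low.twoItems n
    high = High.twoItems n

    -- The only sets that can be queried at this time are the empty set and `⁅u⁆`, whose values do
    -- not depend on the parameters `a` and `b`.
    firstStep-agrees : step A high [] initial zero ≡ step A low [] initial zero
    firstStep-agrees = evaluate-cong agree (onArrival 0 initial 0)
      where
      agree : ∀ j S → Instance.utility high j (select (zero ∷ []) S) ≡
                      Instance.utility low  j (select (zero ∷ []) S)
      agree zero    (inside  ∷ []) = ≡.refl
      agree zero    (outside ∷ []) = ≡.refl
      agree (suc _) _              = ≡.refl

    assignBoth : (d e : Maybe (Fin (suc n))) → Bundles (suc n) 2
    assignBoth d e = assign e (suc zero) (assign d zero (λ _ → ⊥))

    -- Without `u`, bidder zero ends with the empty bundle or `⁅v⁆`, both worthless here.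
    low-value : ∀ d e → d ≢ just zero → Low.value (assignBoth d e zero) ≡ 0#
    low-value (just zero)    e              d≢0 = ⊥-elim (d≢0 ≡.refl)
    low-value nothing        nothing        _   = ≡.refl
    low-value nothing        (just zero)    _   = ≡.refl
    low-value nothing        (just (suc _)) _   = ≡.refl
    low-value (just (suc _)) nothing        _   = ≡.refl
    low-value (just (suc _)) (just zero)    _   = ≡.refl
    low-value (just (suc _)) (just (suc _)) _   = ≡.refl

    -- Having `u`, bidder zero ends with `⁅u⁆` or `uv`. The decision `d` stays a variable because on
    -- an actual run it is `just zero` only propositionally.
    high-value : ∀ {d} e → d ≡ just zero → High.value (assignBoth d e zero) ≤ 1#
    high-value nothing        ≡.refl = ≤-refl
    high-value (just zero)    ≡.refl = <⇒≤ 0<1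
    high-value (just (suc _)) ≡.refl = ≤-refl

    module _ {α} (0<α : 0# < α) (1<αM : 1# < α * M) (competitive : Competitive A α) where

      firstItem-notToFirst : proj₁ (step A low [] initial zero) ≢ just zero
      firstItem-notToFirst d≡0 = α[1+M]≤value (≤-<-trans value≤1 1<α[1+M])
        where
        α[1+M]≤value : α * (1# + M) ≤ High.value (outcome A high zero)
        α[1+M]≤value = High.competitive⇒≤ A competitive ⁅v⁆
          (High.value-≤ (<⇒≤ 0<1+M) (<⇒≤ 1<1+M) ≤-refl (<⇒≤ 0<1+M))

        value≤1 : High.value (outcome A high zero) ≤ 1#
        -- `d≡0` concerns the run on `low`; indistinguishability carries it over to `high`.
        value≤1 = high-value (High.secondDecision A) (≡.trans (≡.cong proj₁ firstStep-agrees) d≡0)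

        1<α[1+M] : 1# < α * (1# + M)
        -- Expanding gives `α + α * M`, which exceeds `α * M` and hence `1#`.
        1<α[1+M] = <-respʳ-≈
          (sym (trans (distribˡ α 1# M) (+-congʳ (*-identityʳ α))))
          (<-trans 1<αM (x<y+x 0<α))

      not-competitive : Empty.⊥
      -- The optimum of `low` is `1#`, so competitiveness would force `α` below the achieved value
      -- `0#`. Being a negation, `α≤value` is applied to the opposite strict inequality.
      not-competitive = α≤value
        (≡.subst (_< α * 1#) (≡.sym (low-value _ (Low.secondDecision A) firstItem-notToFirst))
                 (<-respʳ-≈ (sym (*-identityʳ α)) 0<α))
        where
        α≤value : α * 1# ≤ Low.value (outcome A low zero)
        α≤value = Low.competitive⇒≤ A competitive ⁅u⁆
          (Low.value-≤ (<⇒≤ 0<1) ≤-refl (<⇒≤ 0<1) ≤-refl)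

theorem2 : (ℝ : RealNumbers) →
    let open RealNumbers ℝ
        open OnlineSubmodularWelfare ℝ
    in (M : Carrier) (M>0 : 0# < M) (n : ℕ) .{{_ : NonZero n}} →
       (A : Algorithm n) (α : Carrier) → reciprocal M M>0 < α → ¬ Competitive A α
-- `NonZero` leaves only `suc n`, which supplies bidder zero. The bound on `α` enters in the
-- division-free form `1# < α * M`.
theorem2 ℝ M M>0 (suc n) A α r<α =
  not-competitive M>0 A (reciprocal<⇒pos M>0 r<α) (reciprocal<⇒1<* M>0 r<α)
  where
  open OrderedField ℝ
  open LowerBound ℝ
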